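{- Let $G$ be a finite graph such that $m(G)\geq 2$. Then $$\lceil\log_2(m(G))\rceil\leq p(G)\leq\lceil\log_2(m(G)+1)\rceil.$$
   Context: Graphs are finite, simple and undirected; $G=(V(G),E(G))$, and $G[W]$ is the subgraph induced by $W\subseteq V(G)$. A subset $M\subseteq V(G)$ is a module of $G$ if every vertex $v\in V(G)\setminus M$ is adjacent either to all elements of $M$ or to none of them. The modules $\emptyset$, $V(G)$ and $\{v\}$ ($v\in V(G)$) are trivial. $G$ is prime if $|V(G)|\geq 4$ and all its modules are trivial. A graph $H$ is an extension of $G$ if $V(H)\supseteq V(G)$ and $H[V(G)]=G$; it is a $p$-extension if moreover $|V(H)\setminus V(G)|=p$. The prime bound $p(G)$ is the smallest integer $p$ such that $G$ admits a prime $p$-extension (such an extension is known to exist whenever $|V(G)|\geq 2$). $\omega_M(G)$ is the largest cardinality of a module of $G$ that is a clique in $G$; $\alpha_M(G)=\omega_M(\overline{G})$ is the largest cardinality of a module of $G$ that is a stable set in $G$, where $\overline{G}$ is the complement of $G$; and $m(G)=\max(\alpha_M(G),\omega_M(G))$. -}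

module Defs where

open import Data.Nat using (ℕ; _+_; _≤_; _⊔_)
open import Data.Bool using (Bool; true; false)
open import Data.Fin using (Fin; _↑ˡ_)
open import Data.Fin.Subset using (Subset; _∈_; _∉_; ∣_∣; ⊥; ⊤; ⁅_⁆)
open import Data.Product using (Σ; _×_; ∃)
open import Data.Sum using (_⊎_)
open import Relation.Binary.PropositionalEquality using (_≡_; _≢_)

record Graph (n : ℕ) : Set where
  field
    adj    : Fin n → Fin n → Bool
    sym    : ∀ x y → adj x y ≡ adj y x
    irrefl : ∀ x → adj x x ≡ false
open Graph public

IsModule : ∀ {n} → Graph n → Subset n → Set
IsModule G M = ∀ v → v ∉ M → ∀ x y → x ∈ M → y ∈ M → adj G v x ≡ adj G v y

IsTrivial : ∀ {n} → Subset n → Set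
IsTrivial M = (M ≡ ⊥) ⊎ (M ≡ ⊤) ⊎ ∃ (λ v → M ≡ ⁅ v ⁆)

IsPrime : ∀ {n} → Graph n → Set
IsPrime {n} G = (4 ≤ n) × (∀ M → IsModule G M → IsTrivial M)

IsExtension : ∀ {n} (p : ℕ) → Graph n → Graph (n + p) → Set
IsExtension p G H = ∀ x y → adj H (x ↑ˡ p) (y ↑ˡ p) ≡ adj G x y

HasPrimeExtension : ∀ {n} → Graph n → ℕ → Set
HasPrimeExtension {n} G p = Σ (Graph (n + p)) λ H → IsExtension p G H × IsPrime H

IsPrimeBound : ∀ {n} → Graph n → ℕ → Set
IsPrimeBound G p = HasPrimeExtension G p × (∀ q → HasPrimeExtension G q → p ≤ q)

IsClique : ∀ {n} → Graph n → Subset n → Set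
IsClique G M = ∀ x y → x ∈ M → y ∈ M → x ≢ y → adj G x y ≡ true

IsStable : ∀ {n} → Graph n → Subset n → Set
IsStable G M = ∀ x y → x ∈ M → y ∈ M → adj G x y ≡ false

IsOmegaM : ∀ {n} → Graph n → ℕ → Set
IsOmegaM G k =
  (Σ _ λ M → IsModule G M × IsClique G M × ∣ M ∣ ≡ k)
  × (∀ M → IsModule G M → IsClique G M → ∣ M ∣ ≤ k)

IsAlphaM : ∀ {n} → Graph n → ℕ → Set
IsAlphaM G k =
  (Σ _ λ M → IsModule G M × IsStable G M × ∣ M ∣ ≡ k)
  × (∀ M → IsModule G M → IsStable G M → ∣ M ∣ ≤ k)

{-# OPTIONS --safe #-}
module Submission where

-- Lower bound: a clique or stable module with more than 2 ^ q elements contains two vertices with the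
-- same neighbours among q new vertices, and these form a nontrivial module of the extension.
--
-- Upper bound: up to complementation a largest such module is stable; let C be the twin class containing
-- it, so 2 ^ (p ∸ 1) ≤ ∣ C ∣ < 2 ^ p for p = ⌈log₂ (m + 1)⌉. Make the p new
-- vertices a clique S and join each old vertex v to a subset N(v) of S such that
--   (1) N is injective on every twin class and nonconstant on every minimal module with ≥ 2 elements;
--   (2) N maps C into the nonempty sets, and onto a family containing every singleton;
--   (3) for v outside C, N(v) is not S if v is adjacent to C, and not ∅ otherwise.
-- A module avoiding S is trivial by (1). A module with ≥ 2 elements that meets S contains S, because S is
-- a clique and N attains the singletons on C; it then contains the vertices of C labelled by singletons,
-- and a vertex outside it would have to be labelled S or ∅ in a way excluded by (2) and (3).

open import Defs hiding (sym)
open import Data.Nat using (ℕ; zero; suc; _+_; _*_; _^_; _≤_; _<_; _⊔_; _∸_; z≤n; s≤s; ⌊_/2⌋; ⌈_/2⌉)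
open import Data.Nat.Logarithm using (⌈log₂_⌉)
open import Data.Product using (Σ; _×_; _,_; ∃; ∃₂; proj₁; proj₂)
open import Data.Sum using (_⊎_; inj₁; inj₂; [_,_]′)
open import Data.Bool using (Bool; true; false; not; _∧_; if_then_else_)
import Data.Bool.Properties as Bool
open import Data.Fin using (Fin; zero; suc; toℕ; _↑ˡ_; _↑ʳ_; splitAt; join; combine; remQuot; funToFin; finToFun)
import Data.Fin.Properties as Fin
open import Data.Fin.Properties using (any?; all?; ¬∀⟶∃¬)
open import Data.Fin.Subset using (Subset; _∈_; _∉_; _⊆_; _∩_; _∪_; ∣_∣; ⊥; ⊤; ⁅_⁆; inside; outside)
open import Data.Fin.Subset.Properties
open import Data.Vec using (_∷_; tabulate; lookup; here; there)
import Data.Vec.Properties as Vec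
open import Data.Nat.Induction using (<-wellFounded)
import Data.Nat.Properties as ℕ
import Data.Nat.Logarithm as Log
open import Induction.WellFounded using (Acc; acc)
open import Function using (_∘_)
open import Relation.Nullary using (¬_; Dec; yes; no; does; ¬?; contradiction; _×-dec_; _⊎-dec_; _→-dec_)
open import Relation.Nullary.Decidable using (map′; decidable-stable; dec-true; dec-false)
open import Relation.Unary using (Decidable)
open import Relation.Binary.PropositionalEquality
  using (_≡_; _≢_; refl; sym; trans; cong; cong₂; subst; ≢-sym; module ≡-Reasoning)

private variable
  n p q k : ℕ

-- Finite subsets: comprehension, positions of elements, pairs of distinct elements.

comprehension : {P : Fin n → Set} → Decidable P → Subset n
comprehension P? = tabulate (does ∘ P?)

module _ {P : Fin n → Set} (P? : Decidable P) where

  ∈-comprehension⁺ : ∀ {x} → P x → x ∈ comprehension P?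
  ∈-comprehension⁺ {x} Px = Vec.lookup⇒[]= x _
    (trans (Vec.lookup∘tabulate (does ∘ P?) x) (dec-true (P? x) Px))

  ∈-comprehension⁻ : ∀ {x} → x ∈ comprehension P? → P x
  ∈-comprehension⁻ {x} x∈ with P? x in eq
  ... | yes Px = Px
  ... | no  _  = contradiction
    (trans (sym (Vec.[]=⇒lookup x∈)) (trans (Vec.lookup∘tabulate (does ∘ P?) x) (cong does eq)))
    λ ()

abstract
  allSubset? : {P : Subset n → Set} → Decidable P → Dec (∀ S → P S)
  allSubset? P? = map′
    (λ ¬∃ S → decidable-stable (P? S) (λ ¬PS → ¬∃ (S , ¬PS)))
    (λ ∀P (S , ¬PS) → ¬PS (∀P S))
    (¬? (anySubset? (¬? ∘ P?)))

-- The number of elements of `S` below `x`; on `S` it is the increasing bijection onto the numbers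
-- less than `∣ S ∣`.
position : Subset n → Fin n → ℕ
position (_       ∷ S) zero    = 0
position (inside  ∷ S) (suc x) = suc (position S x)
position (outside ∷ S) (suc x) = position S x

position< : ∀ {S : Subset n} {x} → x ∈ S → position S x < ∣ S ∣
position< {S = inside  ∷ S} here      = s≤s z≤n
position< {S = inside  ∷ S} (there x) = s≤s (position< x)
position< {S = outside ∷ S} (there x) = position< x

position-injective : ∀ {S : Subset n} {x y} → x ∈ S → y ∈ S → position S x ≡ position S y → x ≡ y
position-injective {S = _ ∷ S}       here      here      _  = refl
position-injective {S = inside ∷ S}  (there x) (there y) eq =
  cong suc (position-injective x y (ℕ.suc-injective eq))
position-injective {S = outside ∷ S} (there x) (there y) eq =
  cong suc (position-injective x y eq)

position-surjective : ∀ (S : Subset n) {i} → i < ∣ S ∣ → ∃ λ x → x ∈ S × position S x ≡ i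
position-surjective (inside ∷ S) {zero} _ = zero , here , refl
position-surjective (inside ∷ S) {suc i} (s≤s i<) with x , x∈ , eq ← position-surjective S i< =
  suc x , there x∈ , cong suc eq
position-surjective (outside ∷ S) i< with x , x∈ , eq ← position-surjective S i< =
  suc x , there x∈ , eq

HasPair : Subset n → Set
HasPair S = ∃₂ λ x y → x ∈ S × y ∈ S × x ≢ y

abstract
  hasPair? : Decidable (HasPair {n})
  hasPair? S = any? λ x → any? λ y → (x ∈? S) ×-dec (y ∈? S) ×-dec ¬? (x Fin.≟ y)

hasPair⇒∃≢ : ∀ {S : Subset n} → HasPair S → ∀ v → ∃ λ u → u ∈ S × u ≢ v
hasPair⇒∃≢ (x , y , x∈ , y∈ , x≢y) v with x Fin.≟ v
... | no  x≢v  = x , x∈ , x≢v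
... | yes refl = y , y∈ , ≢-sym x≢y

2≤∣S∣⇒hasPair : ∀ (S : Subset n) → 2 ≤ ∣ S ∣ → HasPair S
2≤∣S∣⇒hasPair S 2≤
  with x , x∈ , px ← position-surjective S {0} (ℕ.<-trans (s≤s z≤n) 2≤)
     | y , y∈ , py ← position-surjective S {1} 2≤
  = x , y , x∈ , y∈ , λ { refl → contradiction (trans (sym px) py) λ () }

¬hasPair⇒∣S∣≤1 : ∀ (S : Subset n) → ¬ HasPair S → ∣ S ∣ ≤ 1
¬hasPair⇒∣S∣≤1 S ¬pair = ℕ.≮⇒≥ (¬pair ∘ 2≤∣S∣⇒hasPair S)

pair : Fin n → Fin n → Subset n
pair x y = ⁅ x ⁆ ∪ ⁅ y ⁆

∈-pairˡ : ∀ (x y : Fin n) → x ∈ pair x y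
∈-pairˡ x y = x∈p∪q⁺ (inj₁ (x∈⁅x⁆ x))

∈-pairʳ : ∀ (x y : Fin n) → y ∈ pair x y
∈-pairʳ x y = x∈p∪q⁺ {p = ⁅ x ⁆} (inj₂ (x∈⁅x⁆ y))

∈-pair⁻ : ∀ {x y z : Fin n} → z ∈ pair x y → z ≡ x ⊎ z ≡ y
∈-pair⁻ {x = x} {y} z∈ = [ inj₁ ∘ x∈⁅y⁆⇒x≡y x , inj₂ ∘ x∈⁅y⁆⇒x≡y y ]′ (x∈p∪q⁻ ⁅ x ⁆ ⁅ y ⁆ z∈)

-- Modules, twins and twin classes.

abstract
  isModule? : ∀ (G : Graph n) → Decidable (IsModule G)
  isModule? G M = all? λ v → ¬? (v ∈? M) →-dec all? λ x → all? λ y →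
    (x ∈? M) →-dec ((y ∈? M) →-dec (adj G v x Bool.≟ adj G v y))

module _ (G : Graph n) where

  -- Equivalently, `pair u v` is a module. Adjacent and nonadjacent twins are treated alike, so one
  -- notion serves cliques and stable sets.
  Twin : Fin n → Fin n → Set
  Twin u v = ∀ w → w ≢ u → w ≢ v → adj G w u ≡ adj G w v

  abstract
    twin? : ∀ v → Decidable (λ u → Twin u v)
    twin? v u = all? λ w → ¬? (w Fin.≟ u) →-dec (¬? (w Fin.≟ v) →-dec (adj G w u Bool.≟ adj G w v))

  twin-refl : ∀ {v} → Twin v v
  twin-refl _ _ _ = refl

  twin-sym : ∀ {u v} → Twin u v → Twin v u
  twin-sym t w w≢v w≢u = sym (t w w≢u w≢v)

  -- Only `z = v` is delicate, since the hypotheses say nothing there; the value is carried around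
  -- the triangle `u`, `v`, `w`, using `vw` at `u` and `uv` at `w`.
  twin-trans : ∀ {u v w} → Twin u v → Twin v w → Twin u w
  twin-trans {u} {v} {w} uv vw z z≢u z≢w with z Fin.≟ v
  ... | no z≢v = trans (uv z z≢u z≢v) (vw z z≢v z≢w)
  ... | yes refl with u Fin.≟ w
  ...   | yes refl = refl
  ...   | no  u≢w  = begin
    adj G v u ≡⟨ Graph.sym G v u ⟩
    adj G u v ≡⟨ vw u (≢-sym z≢u) u≢w ⟩
    adj G u w ≡⟨ Graph.sym G u w ⟩
    adj G w u ≡⟨ uv w (≢-sym u≢w) (≢-sym z≢w) ⟩
    adj G w v ≡⟨ Graph.sym G w v ⟩
    adj G v w ∎
    where open ≡-Reasoning

  twin⇒isModule-pair : ∀ {u v} → Twin u v → IsModule G (pair u v)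
  twin⇒isModule-pair {u} {v} t w w∉ x y x∈ y∈ = trans (toˡ x x∈) (sym (toˡ y y∈))
    where
    toˡ : ∀ x → x ∈ pair u v → adj G w x ≡ adj G w u
    toˡ x x∈ with ∈-pair⁻ x∈
    ... | inj₁ refl = refl
    ... | inj₂ refl = sym (t w (λ { refl → w∉ (∈-pairˡ u v) }) (λ { refl → w∉ (∈-pairʳ u v) }))

  twinClass : Fin n → Subset n
  twinClass v = comprehension (twin? v)

  ∈-twinClass⁺ : ∀ {u v} → Twin u v → u ∈ twinClass v
  ∈-twinClass⁺ {v = v} = ∈-comprehension⁺ (twin? v)

  ∈-twinClass⁻ : ∀ {u v} → u ∈ twinClass v → Twin u v
  ∈-twinClass⁻ {v = v} = ∈-comprehension⁻ (twin? v)

  twinClass-≡ : ∀ {u v} → Twin u v → twinClass u ≡ twinClass v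
  twinClass-≡ t = ⊆-antisym
    (λ x∈ → ∈-twinClass⁺ (twin-trans (∈-twinClass⁻ x∈) t))
    (λ x∈ → ∈-twinClass⁺ (twin-trans (∈-twinClass⁻ x∈) (twin-sym t)))

  twinClass-twins : ∀ {v x y} → x ∈ twinClass v → y ∈ twinClass v → Twin x y
  twinClass-twins x∈ y∈ = twin-trans (∈-twinClass⁻ x∈) (twin-sym (∈-twinClass⁻ y∈))

  isModule-twinClass : ∀ v → IsModule G (twinClass v)
  isModule-twinClass v w w∉ x y x∈ y∈ =
    twinClass-twins x∈ y∈ w (λ { refl → w∉ x∈ }) (λ { refl → w∉ y∈ })

  -- Endpoints can be exchanged for twins one at a time, passing through `a`. Hence a twin class is
  -- a clique or a stable set.
  twinClass-homogeneous : ∀ {v a b x y} → a ∈ twinClass v → b ∈ twinClass v → a ≢ b →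
    x ∈ twinClass v → y ∈ twinClass v → x ≢ y → adj G x y ≡ adj G a b
  twinClass-homogeneous {a = a} {b} {x} {y} a∈ b∈ a≢b x∈ y∈ x≢y with x Fin.≟ a
  ... | yes refl = twinClass-twins y∈ b∈ a (x≢y) a≢b
  ... | no x≢a = begin
    adj G x y ≡⟨ twinClass-twins y∈ a∈ x x≢y x≢a ⟩
    adj G x a ≡⟨ Graph.sym G x a ⟩
    adj G a x ≡⟨ twinClass-twins x∈ b∈ a (≢-sym x≢a) a≢b ⟩
    adj G a b ∎
    where open ≡-Reasoning

  isStable⊎isClique-twinClass : ∀ v → IsStable G (twinClass v) ⊎ IsClique G (twinClass v)
  isStable⊎isClique-twinClass v with hasPair? (twinClass v)
  ... | no ¬pair = inj₂ λ x y x∈ y∈ x≢y → contradiction (x , y , x∈ , y∈ , x≢y) ¬pair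
  ... | yes (a , b , a∈ , b∈ , a≢b) with adj G a b in ab
  ...   | true  = inj₂ λ x y x∈ y∈ x≢y → trans (twinClass-homogeneous a∈ b∈ a≢b x∈ y∈ x≢y) ab
  ...   | false = inj₁ stable
    where
    stable : IsStable G (twinClass v)
    stable x y x∈ y∈ with x Fin.≟ y
    ... | yes refl = irrefl G x
    ... | no  x≢y  = trans (twinClass-homogeneous a∈ b∈ a≢b x∈ y∈ x≢y) ab

  -- Inside `M` nothing is adjacent, and outside it the module property applies; so a stable module
  -- lies in a single twin class.
  stableModule⇒twins : ∀ {M} → IsModule G M → IsStable G M → ∀ {x y} → x ∈ M → y ∈ M → Twin x y
  stableModule⇒twins {M} module-M stable {x} {y} x∈ y∈ w _ _ with w ∈? M
  ... | yes w∈ = trans (stable w x w∈ x∈) (sym (stable w y w∈ y∈))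
  ... | no  w∉ = module-M w w∉ x y x∈ y∈

  -- Minimal modules with at least two vertices.

  Minimal : Subset n → Set
  Minimal P = IsModule G P × HasPair P × (∀ Q → Q ⊆ P → IsModule G Q → HasPair Q → P ⊆ Q)

  -- Injectivity on twin classes already separates a minimal module that contains twins; the
  -- twin-free ones need a mark of their own.
  TwinFree : Subset n → Set
  TwinFree P = ∀ x y → x ∈ P → y ∈ P → x ≢ y → ¬ Twin x y

  abstract
    minimal? : Decidable Minimal
    minimal? P = isModule? G P ×-dec hasPair? P ×-dec
      allSubset? λ Q → (Q ⊆? P) →-dec (isModule? G Q →-dec (hasPair? Q →-dec (P ⊆? Q)))

  abstract
    twinFree? : Decidable TwinFree
    twinFree? P = all? λ x → all? λ y →
      (x ∈? P) →-dec ((y ∈? P) →-dec (¬? (x Fin.≟ y) →-dec ¬? (twin? y x)))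

  ∃-minimal : ∀ N → Acc _<_ ∣ N ∣ → IsModule G N → HasPair N → ∃ λ P → P ⊆ N × Minimal P
  ∃-minimal N (acc rec) module-N pair-N
    with anySubset? (λ Q → (Q ⊂? N) ×-dec isModule? G Q ×-dec hasPair? Q)
  ... | yes (Q , Q⊂N , module-Q , pair-Q)
    with P , P⊆Q , minimal-P ← ∃-minimal Q (rec (p⊂q⇒∣p∣<∣q∣ Q⊂N)) module-Q pair-Q
    = P , ⊆-trans P⊆Q (proj₁ Q⊂N) , minimal-P
  ... | no ¬smaller = N , ⊆-refl , module-N , pair-N , λ Q Q⊆N module-Q pair-Q {x} x∈N →
    decidable-stable (x ∈? Q) λ x∉Q →
      ¬smaller (Q , (Q⊆N , x , x∈N , x∉Q) , module-Q , pair-Q)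

  module _ {P : Subset n} (minimal-P : Minimal P) (twinFree-P : TwinFree P) where

    private
      module-P = proj₁ minimal-P
      pair-P   = proj₁ (proj₂ minimal-P)

    ⊆-least : ∀ Q → Q ⊆ P → IsModule G Q → HasPair Q → P ⊆ Q
    ⊆-least = proj₂ (proj₂ minimal-P)

    -- Otherwise P ∩ K = {v}, and then P ∖ {v} would be a smaller module.
    overlap⇒⊆ : ∀ {K v c} → IsModule G K → v ∈ P → v ∈ K → c ∈ K → c ∉ P → P ⊆ K
    overlap⇒⊆ {K} {v} {c} module-K v∈P v∈K c∈K c∉P
      with any? (λ z → (z ∈? P) ×-dec (z ∈? K) ×-dec ¬? (z Fin.≟ v))
    ... | yes (z , z∈P , z∈K , z≢v) = λ x∈P → proj₂ (x∈p∩q⁻ P K (⊆-least (P ∩ K) (p∩q⊆p P K)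
            module-∩ (z , v , x∈p∩q⁺ (z∈P , z∈K) , x∈p∩q⁺ (v∈P , v∈K) , z≢v) x∈P))
      where
      module-∩ : IsModule G (P ∩ K)
      module-∩ w w∉ x y x∈ y∈ with w ∈? P | x∈p∩q⁻ P K x∈ | x∈p∩q⁻ P K y∈
      ... | no  w∉P | x∈P , _ | y∈P , _ = module-P w w∉P x y x∈P y∈P
      ... | yes w∈P | _ , x∈K | _ , y∈K =
        module-K w (λ w∈K → w∉ (x∈p∩q⁺ (w∈P , w∈K))) x y x∈K y∈K
    -- By minimality `P` would lie in `Q`, which omits `v`.
    ... | no ¬other = contradiction refl (proj₂ (Q⁻ (⊆-least Q (proj₁ ∘ Q⁻) module-Q pair-Q v∈P)))
      where
      Q? : Decidable (λ x → x ∈ P × x ≢ v)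
      Q? x = (x ∈? P) ×-dec ¬? (x Fin.≟ v)

      Q : Subset n
      Q = comprehension Q?

      Q⁻ : ∀ {x} → x ∈ Q → x ∈ P × x ≢ v
      Q⁻ = ∈-comprehension⁻ Q?

      module-Q : IsModule G Q
      module-Q w w∉ x y x∈ y∈ with w ∈? P | w Fin.≟ v | Q⁻ x∈ | Q⁻ y∈
      ... | no w∉P | _ | x∈P , _ | y∈P , _ = module-P w w∉P x y x∈P y∈P
      ... | yes w∈P | no w≢v | _ | _ = contradiction (∈-comprehension⁺ Q? (w∈P , w≢v)) w∉
      -- Any `x` in `P` other than `v` lies outside `K`, so it does not distinguish `v` from `c`;
      -- and `c`, lying outside `P`, sees all of `P` alike.
      ... | yes _ | yes refl | x∈P , x≢v | y∈P , y≢v = begin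
        adj G v x ≡⟨ toC x∈P x≢v ⟩
        adj G c x ≡⟨ module-P c c∉P x y x∈P y∈P ⟩
        adj G c y ≡⟨ toC y∈P y≢v ⟨
        adj G v y ∎
        where
        open ≡-Reasoning
        toC : ∀ {x} → x ∈ P → x ≢ v → adj G v x ≡ adj G c x
        toC {x} x∈P x≢v = begin
          adj G v x ≡⟨ Graph.sym G v x ⟩
          adj G x v ≡⟨ module-K x (λ x∈K → ¬other (x , x∈P , x∈K , x≢v)) v c v∈K c∈K ⟩
          adj G x c ≡⟨ Graph.sym G x c ⟩
          adj G c x ∎

      pair-Q : HasPair Q
      pair-Q with u , u∈P , u≢v ← hasPair⇒∃≢ pair-P v
        with any? (λ w → Q? w ×-dec ¬? (w Fin.≟ u))
      ... | yes (w , w∈ , w≢u) = w , u , ∈-comprehension⁺ Q? w∈ , ∈-comprehension⁺ Q? (u∈P , u≢v) , w≢u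
      -- Without a third vertex, `P` would consist of `u` and `v`, which would then be twins.
      ... | no ¬third = contradiction twin (twinFree-P u v u∈P v∈P u≢v)
        where
        twin : Twin u v
        twin w w≢u w≢v = module-P w (λ w∈P → ¬third (w , (w∈P , w≢v) , w≢u)) u v u∈P v∈P

    -- A twin `u` outside `P` would make `pair u v` a module overlapping `P`; then `P` would lie in
    -- that pair and have `v` as its only element.
    twin⇒≡ : ∀ {u v} → v ∈ P → Twin u v → u ≡ v
    twin⇒≡ {u} {v} v∈P t with u Fin.≟ v | u ∈? P
    ... | yes u≡v | _ = u≡v
    ... | no u≢v | yes u∈P = contradiction t (twinFree-P u v u∈P v∈P u≢v)
    ... | no u≢v | no u∉P
      with w , w∈P , w≢v ← hasPair⇒∃≢ pair-P v
      with ∈-pair⁻ (overlap⇒⊆ (twin⇒isModule-pair t) v∈P (∈-pairʳ u v) (∈-pairˡ u v) u∉P w∈P)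
    ...   | inj₁ refl = contradiction w∈P u∉P
    ...   | inj₂ w≡v  = contradiction w≡v w≢v

    meet⇒⊆ : ∀ {K v} → IsModule G K → HasPair K → v ∈ P → v ∈ K → P ⊆ K
    meet⇒⊆ {K} module-K pair-K v∈P v∈K with any? (λ c → (c ∈? K) ×-dec ¬? (c ∈? P))
    ... | yes (c , c∈K , c∉P) = overlap⇒⊆ module-K v∈P v∈K c∈K c∉P
    ... | no ¬outside = ⊆-least K
      (λ {c} c∈K → decidable-stable (c ∈? P) (λ c∉P → ¬outside (c , c∈K , c∉P)))
      module-K pair-K

  minimal-≡ : ∀ {P Q v} → Minimal P → TwinFree P → Minimal Q → TwinFree Q → v ∈ P → v ∈ Q → P ≡ Q
  minimal-≡ mP@(modP , pairP , _) tP mQ@(modQ , pairQ , _) tQ v∈P v∈Q = ⊆-antisym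
    (meet⇒⊆ mP tP modQ pairQ v∈P v∈Q) (meet⇒⊆ mQ tQ modP pairP v∈Q v∈P)

-- Binary digits.

odd : ℕ → Bool
odd zero          = false
odd (suc zero)    = true
odd (suc (suc k)) = odd k

-- Least significant digit first; numbers below `2 ^ p` thereby encode the subsets of `Fin p`.
bit : ℕ → Fin p → Bool
bit k zero    = odd k
bit k (suc i) = bit ⌊ k /2⌋ i

halve : ∀ k → k ≡ (if odd k then 1 else 0) + 2 * ⌊ k /2⌋
halve zero       = refl
halve (suc zero) = refl
halve (suc (suc k)) = begin
  2 + k               ≡⟨ cong (2 +_) (halve k) ⟩
  2 + (b + 2 * h)     ≡⟨ ℕ.+-assoc 2 b (2 * h) ⟨
  2 + b + 2 * h       ≡⟨ cong (_+ 2 * h) (ℕ.+-comm 2 b) ⟩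
  b + 2 + 2 * h       ≡⟨ ℕ.+-assoc b 2 (2 * h) ⟩
  b + (2 + 2 * h)     ≡⟨ cong (b +_) (ℕ.*-suc 2 h) ⟨
  b + 2 * suc h       ∎
  where
  open ≡-Reasoning
  b = if odd k then 1 else 0
  h = ⌊ k /2⌋

odd-double : ∀ k → odd (2 * k) ≡ false
odd-double zero = refl
odd-double (suc k) rewrite ℕ.*-suc 2 k = odd-double k

⌊2k/2⌋≡k : ∀ k → ⌊ 2 * k /2⌋ ≡ k
⌊2k/2⌋≡k zero = refl
⌊2k/2⌋≡k (suc k) rewrite ℕ.*-suc 2 k = cong suc (⌊2k/2⌋≡k k)

⌊/2⌋<2^ : ∀ p {k} → k < 2 ^ suc p → ⌊ k /2⌋ < 2 ^ p
⌊/2⌋<2^ p {k} k< = ℕ.*-cancelˡ-< 2 _ _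
  (ℕ.≤-<-trans (ℕ.≤-trans (ℕ.m≤n+m _ (if odd k then 1 else 0)) (ℕ.≤-reflexive (sym (halve k)))) k<)

bit-injective : ∀ p {k l} → k < 2 ^ p → l < 2 ^ p → (∀ (i : Fin p) → bit k i ≡ bit l i) → k ≡ l
bit-injective zero    (s≤s z≤n) (s≤s z≤n) _ = refl
bit-injective (suc p) {k} {l} k< l< same = trans (halve k) (trans
  (cong₂ (λ b h → (if b then 1 else 0) + 2 * h) (same zero)
    (bit-injective p (⌊/2⌋<2^ p k<) (⌊/2⌋<2^ p l<) (same ∘ suc)))
  (sym (halve l)))

suc[2^k∸1] : ∀ k → suc (2 ^ k ∸ 1) ≡ 2 ^ k
suc[2^k∸1] k = ℕ.m+[n∸m]≡n (ℕ.m^n>0 2 k)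

bit-0 : ∀ (i : Fin p) → bit 0 i ≡ false
bit-0 zero    = refl
bit-0 (suc i) = bit-0 i

-- Below `2 ^ p`, only `2 ^ p ∸ 1` encodes the full subset.
bits-true⇒2^≤ : ∀ p k → (∀ (i : Fin p) → bit k i ≡ true) → 2 ^ p ≤ suc k
bits-true⇒2^≤ zero    k _ = s≤s z≤n
bits-true⇒2^≤ (suc p) k ones = begin
  2 * 2 ^ p                                        ≤⟨ ℕ.*-monoʳ-≤ 2 (bits-true⇒2^≤ p ⌊ k /2⌋ (ones ∘ suc)) ⟩
  2 * suc ⌊ k /2⌋                                  ≡⟨ ℕ.*-suc 2 ⌊ k /2⌋ ⟩
  suc (1 + 2 * ⌊ k /2⌋)                            ≡⟨ cong (λ b → suc ((if b then 1 else 0) + 2 * ⌊ k /2⌋)) (ones zero) ⟨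
  suc ((if odd k then 1 else 0) + 2 * ⌊ k /2⌋)     ≡⟨ cong suc (halve k) ⟨
  suc k                                            ∎
  where open ℕ.≤-Reasoning

bit-2^-same : ∀ (t : Fin p) → bit (2 ^ toℕ t) t ≡ true
bit-2^-same zero = refl
bit-2^-same (suc t) rewrite ⌊2k/2⌋≡k (2 ^ toℕ t) = bit-2^-same t

bit-2^-other : ∀ (t i : Fin p) → t ≢ i → bit (2 ^ toℕ t) i ≡ false
bit-2^-other zero    zero    t≢i = contradiction refl t≢i
bit-2^-other zero    (suc i) _   = bit-0 i
bit-2^-other (suc t) zero    _   = odd-double (2 ^ toℕ t)
bit-2^-other (suc t) (suc i) t≢i rewrite ⌊2k/2⌋≡k (2 ^ toℕ t) = bit-2^-other t i (t≢i ∘ cong suc)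

-- The labelling of the old vertices in the stable case.

isTrivial-fromPairs : ∀ (M : Subset n) → (∀ x y → x ∈ M → y ∈ M → x ≢ y → ∀ z → z ∈ M) → IsTrivial M
isTrivial-fromPairs M full with nonempty? M
... | no empty = inj₁ (Empty-unique empty)
... | yes (x , x∈) with any? (λ y → (y ∈? M) ×-dec ¬? (y Fin.≟ x))
...   | yes (y , y∈ , y≢x) = inj₂ (inj₁ (⊆-antisym ⊆⊤ (λ {z} _ → full y x y∈ x∈ y≢x z)))
...   | no ¬other = inj₂ (inj₂ (x , ⊆-antisym
  (λ {y} y∈ → subst (_∈ ⁅ x ⁆)
    (sym (decidable-stable (y Fin.≟ x) (λ y≢x → ¬other (y , y∈ , y≢x)))) (x∈⁅x⁆ x))
  (λ y∈ → subst (_∈ M) (sym (x∈⁅y⁆⇒x≡y x y∈)) x∈)))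

∃-≢ : ∀ (t : Fin (2 + n)) → ∃ λ t′ → t ≢ t′
∃-≢ zero    = suc zero , λ ()
∃-≢ (suc _) = zero     , λ ()

-- `small` lets every twin class take distinct labels, even counted from 1. `large`, at the last
-- `t`, gives the class of `v₀` at least half of `2 ^ (2 + q)` vertices, enough to reach every power
-- of two.
module Construction {n} (G : Graph n) (q : ℕ) (v₀ : Fin n)
  (stable-v₀ : IsStable G (twinClass G v₀))
  (small : ∀ v → ∣ twinClass G v ∣ < 2 ^ (2 + q))
  (large : ∀ (t : Fin (2 + q)) → 2 ^ toℕ t ≤ ∣ twinClass G v₀ ∣)
  where

  -- Minimal twin-free modules are pairwise disjoint, so marking the first vertex of each one
  -- makes the labelling nonconstant on all of them.
  Special : Fin n → Set
  Special v = ∃ λ P → Minimal G P × TwinFree G P × v ∈ P × position P v ≡ 0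

  abstract
    special? : Decidable Special
    special? v = anySubset? λ P → minimal? G P ×-dec twinFree? G P ×-dec (v ∈? P) ×-dec (position P v ℕ.≟ 0)

    -- A special vertex has no twin but itself, so its position would be 0, as for the other
    -- vertices of its minimal module; the value 1 sets it apart.
    rank : Fin n → ℕ
    rank v = if does (special? v) then 1 else position (twinClass G v) v

    rank-special : ∀ {v} → Special v → rank v ≡ 1
    rank-special {v} s rewrite dec-true (special? v) s = refl

    rank-¬special : ∀ {v} → ¬ Special v → rank v ≡ position (twinClass G v) v
    rank-¬special {v} ¬s rewrite dec-false (special? v) ¬s = refl

  self∈ : ∀ {v} → v ∈ twinClass G v
  self∈ = ∈-twinClass⁺ G (twin-refl G)

  2<2^ : ∀ q → 2 < 2 ^ (2 + q)
  2<2^ q = ℕ.≤-trans (ℕ.m≤m+n 3 1) (ℕ.^-monoʳ-≤ 2 {2} (ℕ.m≤m+n 2 q))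

  -- The extra `suc` leaves room for a shift by 1 and keeps unshifted labels from being full.
  rank< : ∀ v → suc (rank v) < 2 ^ (2 + q)
  rank< v with special? v
  ... | yes s rewrite rank-special s   = 2<2^ q
  ... | no ¬s rewrite rank-¬special ¬s = ℕ.≤-<-trans (position< self∈) (small v)

  -- Adding 1 keeps the label of a vertex not adjacent to `v₀` nonempty; leaving it out keeps the
  -- label of a neighbour of `v₀` from being full.
  shift : Fin n → ℕ
  shift v = if adj G v v₀ then 0 else 1

  -- The bits of label v are the new neighbours of v. On the class of v₀ the label is
  -- position + 1, so it runs over 1, …, ∣ twinClass G v₀ ∣ and meets every power of two.
  label : Fin n → ℕ
  label v = shift v + rank v

  -- A module of the extension containing all new vertices would force this labelling outside itself.
  label-unforced : ∀ v → ¬ (∀ (t : Fin (2 + q)) → bit (label v) t ≡ adj G v v₀)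
  label-unforced v forced with adj G v v₀
  ... | true  = ℕ.<⇒≱ (rank< v) (bits-true⇒2^≤ (2 + q) (rank v) forced)
  ... | false = contradiction
    (bit-injective (2 + q) (rank< v) (ℕ.m^n>0 2 (2 + q)) (λ t → trans (forced t) (sym (bit-0 t)))) λ ()

  label< : ∀ v → label v < 2 ^ (2 + q)
  label< v with adj G v v₀
  ... | true  = ℕ.<-trans (ℕ.n<1+n _) (rank< v)
  ... | false = rank< v

  twins⇒¬special : ∀ {u v} → Twin G u v → u ≢ v → ¬ Special v
  twins⇒¬special t u≢v (P , minimal-P , free-P , v∈P , _) =
    u≢v (twin⇒≡ G minimal-P free-P v∈P t)

  v₀-twin : ∃ λ u → Twin G u v₀ × u ≢ v₀
  v₀-twin with u , u∈ , u≢ ← hasPair⇒∃≢ (2≤∣S∣⇒hasPair _ (large (suc zero))) v₀ = u , ∈-twinClass⁻ G u∈ , u≢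

  shift-equal : ∀ {u v} → adj G u v₀ ≡ adj G v v₀ → shift u ≡ shift v
  shift-equal = cong λ b → if b then 0 else 1

  adj-class-v₀ : ∀ {x} → x ∈ twinClass G v₀ → adj G x v₀ ≡ false
  adj-class-v₀ x∈ = stable-v₀ _ v₀ x∈ self∈

  -- Twins agree at `v₀` unless one of them is `v₀`; then both lie in its stable twin class.
  shift-twins : ∀ {u v} → Twin G u v → shift u ≡ shift v
  shift-twins {u} {v} t with v₀ Fin.≟ u | v₀ Fin.≟ v
  ... | yes refl | _ = shift-equal (trans (adj-class-v₀ self∈) (sym (adj-class-v₀ (∈-twinClass⁺ G (twin-sym G t)))))
  ... | no _ | yes refl = shift-equal (trans (adj-class-v₀ (∈-twinClass⁺ G t)) (sym (adj-class-v₀ self∈)))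
  ... | no v₀≢u | no v₀≢v = shift-equal
    (trans (Graph.sym G u v₀) (trans (t v₀ v₀≢u v₀≢v) (Graph.sym G v₀ v)))

  -- Distinct twins are not special and have equal shifts, so their labels differ as their positions
  -- in the common class do.
  label-twins : ∀ {u v} → Twin G u v → u ≢ v → label u ≢ label v
  label-twins {u} {v} t u≢v eq = u≢v (position-injective (∈-twinClass⁺ G t) self∈ (begin
    position (twinClass G v) u ≡⟨ cong (λ C → position C u) (twinClass-≡ G t) ⟨
    position (twinClass G u) u ≡⟨ rank-¬special (twins⇒¬special (twin-sym G t) (≢-sym u≢v)) ⟨
    rank u                     ≡⟨ ℕ.+-cancelˡ-≡ (shift v) _ _ (trans (cong (_+ rank u) (sym (shift-twins t))) eq) ⟩
    rank v                     ≡⟨ rank-¬special (twins⇒¬special t u≢v) ⟩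
    position (twinClass G v) v ∎))
    where open ≡-Reasoning

  rank-untwinned : ∀ {v} → (∀ u → Twin G u v → u ≡ v) → rank v ≡ 1 → Special v
  rank-untwinned {v} untwinned rank≡1 = decidable-stable (special? v) λ ¬s →
    ℕ.<-irrefl refl (begin-strict
      1                          ≡⟨ trans (sym rank≡1) (rank-¬special ¬s) ⟩
      position (twinClass G v) v <⟨ position< self∈ ⟩
      ∣ twinClass G v ∣          ≤⟨ ¬hasPair⇒∣S∣≤1 _ (λ (x , y , x∈ , y∈ , x≢y) → x≢y
          (trans (untwinned x (∈-twinClass⁻ G x∈)) (sym (untwinned y (∈-twinClass⁻ G y∈))))) ⟩
      1                          ∎)
    where open ℕ.≤-Reasoning

  -- The first vertex `v` of `P` has rank 1, while any other vertex `u` is untwinned and unmarked.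
  -- Their shifts agree, because `v₀` has a twin and so lies outside the module `P`.
  label-twinFree : ∀ {P} → Minimal G P → TwinFree G P → ∃₂ λ u v → u ∈ P × v ∈ P × label u ≢ label v
  label-twinFree {P} minimal-P@(module-P , pair-P@(a , _ , a∈P , _) , _) free-P
    with v , v∈P , pos-v ← position-surjective P (ℕ.≤-<-trans z≤n (position< a∈P))
    with u , u∈P , u≢v ← hasPair⇒∃≢ pair-P v
    = u , v , u∈P , v∈P , λ eq → u-¬special (rank-untwinned (λ w → twin⇒≡ G minimal-P free-P u∈P)
        (trans (ℕ.+-cancelˡ-≡ (shift v) _ _ (trans (cong (_+ rank u) (sym shift-u≡v)) eq))
          (rank-special (P , minimal-P , free-P , v∈P , pos-v))))
    where
    v₀∉P : v₀ ∉ P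
    v₀∉P v₀∈P with u , t , u≢v₀ ← v₀-twin = u≢v₀ (twin⇒≡ G minimal-P free-P v₀∈P t)

    shift-u≡v : shift u ≡ shift v
    shift-u≡v = shift-equal (trans (Graph.sym G u v₀)
      (trans (module-P v₀ v₀∉P u v u∈P v∈P) (Graph.sym G v₀ v)))

    u-¬special : ¬ Special u
    u-¬special (Q , minimal-Q , free-Q , u∈Q , pos-u)
      with refl ← minimal-≡ G minimal-P free-P minimal-Q free-Q u∈P u∈Q
      = u≢v (position-injective u∈P v∈P (trans pos-u (sym pos-v)))

  -- Constancy would pass to a minimal module inside `N`, where either a pair of twins or the marked
  -- vertex contradicts it.
  label-nonconstant : ∀ N → IsModule G N → HasPair N → ¬ (∀ u v → u ∈ N → v ∈ N → label u ≡ label v)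
  label-nonconstant N module-N pair-N constant
    with P , P⊆N , minimal-P ← ∃-minimal G N (<-wellFounded _) module-N pair-N
    with twinFree? G P
  ... | yes free-P with u , v , u∈P , v∈P , ≢ ← label-twinFree minimal-P free-P
    = ≢ (constant u v (P⊆N u∈P) (P⊆N v∈P))
  ... | no ¬free-P = ¬free-P λ x y x∈P y∈P x≢y t →
    label-twins t x≢y (constant x y (P⊆N x∈P) (P⊆N y∈P))

  singleton-label : ∀ (t : Fin (2 + q)) → ∃ λ x → x ∈ twinClass G v₀ × label x ≡ 2 ^ toℕ t
  singleton-label t
    -- The shift is 1 on this class, so label `2 ^ toℕ t` sits at position `2 ^ toℕ t ∸ 1`.
    with x , x∈ , pos-x ← position-surjective (twinClass G v₀) {2 ^ toℕ t ∸ 1}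
      (subst (_≤ ∣ twinClass G v₀ ∣) (sym (suc[2^k∸1] (toℕ t))) (large t))
    = x , x∈ , (begin
      shift x + rank x               ≡⟨ cong (λ b → (if b then 0 else 1) + rank x) (adj-class-v₀ x∈) ⟩
      suc (rank x)                   ≡⟨ cong suc (rank-¬special x-¬special) ⟩
      suc (position (twinClass G x) x)  ≡⟨ cong (λ C → suc (position C x)) (twinClass-≡ G (∈-twinClass⁻ G x∈)) ⟩
      suc (position (twinClass G v₀) x) ≡⟨ cong suc pos-x ⟩
      suc (2 ^ toℕ t ∸ 1)            ≡⟨ suc[2^k∸1] (toℕ t) ⟩
      2 ^ toℕ t                      ∎)
    where
    open ≡-Reasoning
    x-¬special : ¬ Special x
    x-¬special with u , u∈ , u≢x ← hasPair⇒∃≢ (2≤∣S∣⇒hasPair _ (large (suc zero))) x =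
      twins⇒¬special (twinClass-twins G u∈ x∈) u≢x

  singleton-bit-same : ∀ t → bit (label (proj₁ (singleton-label t))) t ≡ true
  singleton-bit-same t = trans (cong (λ k → bit k t) (proj₂ (proj₂ (singleton-label t)))) (bit-2^-same t)

  singleton-bit-other : ∀ t s → t ≢ s → bit (label (proj₁ (singleton-label t))) s ≡ false
  singleton-bit-other t s t≢s =
    trans (cong (λ k → bit k s) (proj₂ (proj₂ (singleton-label t)))) (bit-2^-other t s t≢s)

  -- The extension and its modules.

  S : Set
  S = Fin (2 + q)

  adj⊎ : Fin n ⊎ S → Fin n ⊎ S → Bool
  adj⊎ (inj₁ x) (inj₁ y) = adj G x y
  adj⊎ (inj₁ x) (inj₂ t) = bit (label x) t
  adj⊎ (inj₂ s) (inj₁ y) = bit (label y) s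
  adj⊎ (inj₂ s) (inj₂ t) = not (does (s Fin.≟ t))

  adj⊎-sym : ∀ a b → adj⊎ a b ≡ adj⊎ b a
  adj⊎-sym (inj₁ x) (inj₁ y) = Graph.sym G x y
  adj⊎-sym (inj₁ _) (inj₂ _) = refl
  adj⊎-sym (inj₂ _) (inj₁ _) = refl
  adj⊎-sym (inj₂ s) (inj₂ t) with s Fin.≟ t | t Fin.≟ s
  ... | yes _   | yes _   = refl
  ... | no  _   | no  _   = refl
  ... | yes s≡t | no  t≢s = contradiction (sym s≡t) t≢s
  ... | no  s≢t | yes t≡s = contradiction (sym t≡s) s≢t

  adj⊎-irrefl : ∀ a → adj⊎ a a ≡ false
  adj⊎-irrefl (inj₁ x) = irrefl G x
  adj⊎-irrefl (inj₂ s) rewrite dec-true (s Fin.≟ s) refl = refl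

  split : Fin (n + (2 + q)) → Fin n ⊎ S
  split = splitAt n

  H : Graph (n + (2 + q))
  H = record
    { adj    = λ x y → adj⊎ (split x) (split y)
    ; sym    = λ x y → adj⊎-sym (split x) (split y)
    ; irrefl = λ x → adj⊎-irrefl (split x)
    }

  ext : IsExtension (2 + q) G H
  ext x y rewrite Fin.splitAt-↑ˡ n x (2 + q) | Fin.splitAt-↑ˡ n y (2 + q) = refl

  unsplit : Fin n ⊎ S → Fin (n + (2 + q))
  unsplit = join n (2 + q)

  module _ (N : Subset (n + (2 + q))) (module-N : IsModule H N)  where

    _∈N : Fin n ⊎ S → Set
    a ∈N = unsplit a ∈ N

    module⊎ : ∀ a b c → ¬ a ∈N → b ∈N → c ∈N → adj⊎ a b ≡ adj⊎ a c
    module⊎ a b c a∉ b∈ c∈ = begin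
      adj⊎ a b ≡⟨ cong₂ adj⊎ (split-join a) (split-join b) ⟨
      adj⊎ (split (unsplit a)) (split (unsplit b)) ≡⟨ module-N _ a∉ _ _ b∈ c∈ ⟩
      adj⊎ (split (unsplit a)) (split (unsplit c)) ≡⟨ cong₂ adj⊎ (split-join a) (split-join c) ⟩
      adj⊎ a c ∎
      where
      open ≡-Reasoning
      split-join = Fin.splitAt-join n (2 + q)

    old? : Decidable (λ x → inj₁ x ∈N)
    old? x = unsplit (inj₁ x) ∈? N

    isModule-old : IsModule G (comprehension old?)
    isModule-old w w∉ x y x∈ y∈ = module⊎ (inj₁ w) (inj₁ x) (inj₁ y)
      (w∉ ∘ ∈-comprehension⁺ old?) (∈-comprehension⁻ old? x∈) (∈-comprehension⁻ old? y∈)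

    -- If no new vertex belonged to `N`, none would distinguish its old vertices, so the label would
    -- be constant on a module of `G` with two elements.
    ∃-new : ∀ {x y} → inj₁ x ∈N → inj₁ y ∈N → x ≢ y → ∃ λ t → inj₂ t ∈N
    ∃-new {x} {y} x∈ y∈ x≢y with any? (λ t → unsplit (inj₂ t) ∈? N)
    ... | yes new = new
    ... | no ¬new = contradiction
      (λ u v u∈ v∈ → bit-injective (2 + q) (label< u) (label< v) λ t →
        module⊎ (inj₂ t) (inj₁ u) (inj₁ v) (λ t∈ → ¬new (t , t∈))
          (∈-comprehension⁻ old? u∈) (∈-comprehension⁻ old? v∈))
      (label-nonconstant _ isModule-old
        (x , y , ∈-comprehension⁺ old? x∈ , ∈-comprehension⁺ old? y∈ , x≢y))

    -- Suppose `s` is missing. It sees `t` but not `xₜ`, so `xₜ` is outside `N` and, seeing `t`,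
    -- sees all of `N`. Then `xₛ`, not adjacent to `xₜ`, is outside too and, missing `t`, misses all
    -- of `N`. Now `b` cannot be new, since `xₜ` sees only `t` there, nor old, since `xₜ` and `xₛ`
    -- are twins.
    all-new : ∀ t b → inj₂ t ∈N → b ∈N → inj₂ t ≢ b → ∀ s → inj₂ s ∈N
    all-new t b t∈ b∈ t≢b s = decidable-stable (unsplit (inj₂ s) ∈? N) λ s∉ → absurd s∉ b b∈ t≢b
      where
      xₜ = proj₁ (singleton-label t)
      xₛ = proj₁ (singleton-label s)
      xₜ∈C = proj₁ (proj₂ (singleton-label t))
      xₛ∈C = proj₁ (proj₂ (singleton-label s))

      absurd : ¬ inj₂ s ∈N → ∀ b → b ∈N → ¬ (inj₂ t ≢ b)
      absurd s∉ b b∈ t≢b = xₜ∉b b b∈ t≢b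
        where
        s≢t : s ≢ t
        s≢t refl = s∉ t∈

        xₜ∉ : ¬ inj₁ xₜ ∈N
        xₜ∉ xₜ∈ = contradiction (begin
          true                        ≡⟨ cong not (dec-false (s Fin.≟ t) s≢t) ⟨
          adj⊎ (inj₂ s) (inj₂ t)      ≡⟨ module⊎ (inj₂ s) (inj₂ t) (inj₁ xₜ) s∉ t∈ xₜ∈ ⟩
          bit (label xₜ) s            ≡⟨ singleton-bit-other t s (≢-sym s≢t) ⟩
          false                       ∎) λ ()
          where open ≡-Reasoning

        sees-b : ∀ b → b ∈N → adj⊎ (inj₁ xₜ) b ≡ true
        sees-b b b∈ = trans (module⊎ (inj₁ xₜ) b (inj₂ t) xₜ∉ b∈ t∈) (singleton-bit-same t)

        xₛ∉ : ¬ inj₁ xₛ ∈N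
        xₛ∉ xₛ∈ = contradiction (trans (sym (sees-b (inj₁ xₛ) xₛ∈)) (stable-v₀ xₜ xₛ xₜ∈C xₛ∈C)) λ ()

        misses-b : ∀ b → b ∈N → adj⊎ (inj₁ xₛ) b ≡ false
        misses-b b b∈ = trans (module⊎ (inj₁ xₛ) b (inj₂ t) xₛ∉ b∈ t∈) (singleton-bit-other s t s≢t)

        xₜ∉b : ∀ b → b ∈N → ¬ (inj₂ t ≢ b)
        xₜ∉b (inj₂ u) u∈ t≢u = contradiction
          (trans (sym (sees-b (inj₂ u) u∈)) (singleton-bit-other t u (t≢u ∘ cong inj₂))) λ ()
        xₜ∉b (inj₁ w) w∈ _ = contradiction (begin
          true          ≡⟨ sees-b (inj₁ w) w∈ ⟨
          adj G xₜ w    ≡⟨ Graph.sym G xₜ w ⟩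
          adj G w xₜ    ≡⟨ twinClass-twins G xₜ∈C xₛ∈C w (λ { refl → xₜ∉ w∈ }) (λ { refl → xₛ∉ w∈ }) ⟩
          adj G w xₛ    ≡⟨ Graph.sym G w xₛ ⟩
          adj G xₛ w    ≡⟨ misses-b (inj₁ w) w∈ ⟩
          false         ∎) λ ()
          where open ≡-Reasoning

    module _ (all-new∈ : ∀ t → inj₂ t ∈N) where

      -- The vertex labelled by `t` alone distinguishes `t` from another new vertex `t′`, which
      -- exists because there are at least two.
      singleton∈ : ∀ t → inj₁ (proj₁ (singleton-label t)) ∈N
      singleton∈ t = decidable-stable (_ ∈? N) λ x∉ → contradiction (begin
        true                 ≡⟨ singleton-bit-same t ⟨
        bit (label x) t      ≡⟨ module⊎ (inj₁ x) (inj₂ t) (inj₂ t′) x∉ (all-new∈ t) (all-new∈ t′) ⟩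
        bit (label x) t′     ≡⟨ singleton-bit-other t t′ t≢t′ ⟩
        false                ∎) λ ()
        where
        open ≡-Reasoning
        x = proj₁ (singleton-label t)
        t′ = proj₁ (∃-≢ t)
        t≢t′ = proj₂ (∃-≢ t)

      -- Outside `N`, `v` must see every new vertex as it sees a member of the class of `v₀`.
      label-forced : ∀ {v} → ¬ inj₁ v ∈N → ∀ t → bit (label v) t ≡ adj G v v₀
      label-forced {v} v∉ t = trans
        (module⊎ (inj₁ v) (inj₂ t) (inj₁ x) v∉ (all-new∈ t) (singleton∈ t)) adj-x
        where
        x = proj₁ (singleton-label t)
        x∈C = proj₁ (proj₂ (singleton-label t))
        adj-x : adj G v x ≡ adj G v v₀
        adj-x with v Fin.≟ v₀
        ... | yes refl = trans (stable-v₀ v x self∈ x∈C) (sym (irrefl G v))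
        ... | no v≢v₀ = ∈-twinClass⁻ G x∈C v (λ { refl → v∉ (singleton∈ t) }) v≢v₀

      all-old : ∀ v → inj₁ v ∈N
      all-old v = decidable-stable (_ ∈? N) λ v∉ → label-unforced v (label-forced v∉)

    all-∈-new : ∀ t b → inj₂ t ∈N → b ∈N → inj₂ t ≢ b → ∀ c → c ∈N
    all-∈-new t b t∈ b∈ t≢b (inj₂ s) = all-new t b t∈ b∈ t≢b s
    all-∈-new t b t∈ b∈ t≢b (inj₁ v) = all-old (all-new t b t∈ b∈ t≢b) v

    all-∈ : ∀ a b → a ∈N → b ∈N → a ≢ b → ∀ c → c ∈N
    all-∈ (inj₂ t) b        a∈ b∈ a≢b = all-∈-new t b a∈ b∈ a≢b
    all-∈ (inj₁ x) (inj₂ t) a∈ b∈ a≢b = all-∈-new t (inj₁ x) b∈ a∈ (≢-sym a≢b)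
    all-∈ (inj₁ x) (inj₁ y) a∈ b∈ a≢b with t , t∈ ← ∃-new a∈ b∈ (a≢b ∘ cong inj₁) =
      all-∈-new t (inj₁ x) t∈ a∈ (λ ())

  isPrime-H : IsPrime H
  isPrime-H = 4≤ , λ N module-N → isTrivial-fromPairs N λ x y x∈ y∈ x≢y z →
    subst (_∈ N) (join-split z) (all-∈ N module-N (split x) (split y)
      (subst (_∈ N) (sym (join-split x)) x∈) (subst (_∈ N) (sym (join-split y)) y∈)
      (λ eq → x≢y (trans (sym (join-split x)) (trans (cong unsplit eq) (join-split y)))) (split z))
    where
    join-split = Fin.join-splitAt n (2 + q)
    4≤ : 4 ≤ n + (2 + q)
    4≤ = ℕ.+-mono-≤ (ℕ.≤-trans (large (suc zero)) (∣p∣≤n (twinClass G v₀))) (ℕ.m≤m+n 2 q)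

  hasPrimeExtension : HasPrimeExtension G (2 + q)
  hasPrimeExtension = H , ext , isPrime-H

-- Complementation, which reduces the clique case to the stable case.

complement : Graph n → Graph n
complement G = record
  { adj    = coadj
  ; sym    = coadj-sym
  ; irrefl = coadj-irrefl
  }
  where
  coadj : Fin _ → Fin _ → Bool
  coadj x y = if does (x Fin.≟ y) then false else not (adj G x y)

  coadj-sym : ∀ x y → coadj x y ≡ coadj y x
  coadj-sym x y with x Fin.≟ y | y Fin.≟ x
  ... | yes _   | yes _   = refl
  ... | no  _   | no  _   = cong not (Graph.sym G x y)
  ... | yes x≡y | no  y≢x = contradiction (sym x≡y) y≢x
  ... | no  x≢y | yes y≡x = contradiction (sym y≡x) x≢y

  coadj-irrefl : ∀ x → coadj x x ≡ false
  coadj-irrefl x rewrite dec-true (x Fin.≟ x) refl = refl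

adj-complement : ∀ (G : Graph n) {x y} → x ≢ y → adj (complement G) x y ≡ not (adj G x y)
adj-complement G {x} {y} x≢y rewrite dec-false (x Fin.≟ y) x≢y = refl

complement-involutive : ∀ (G : Graph n) x y → adj (complement (complement G)) x y ≡ adj G x y
complement-involutive G x y with x Fin.≟ y
... | yes refl = sym (irrefl G x)
... | no  x≢y = Bool.not-involutive _

-- Double complements and decoded graphs are compared with the original only through their adjacency
-- values, so properties are transported along pointwise equality.
isModule-resp : ∀ {G H : Graph n} → (∀ x y → adj G x y ≡ adj H x y) → ∀ {M} → IsModule G M → IsModule H M
isModule-resp G≗H module-M v v∉ x y x∈ y∈ =
  trans (sym (G≗H v x)) (trans (module-M v v∉ x y x∈ y∈) (G≗H v y))

isPrime-resp : ∀ {G H : Graph n} → (∀ x y → adj G x y ≡ adj H x y) → IsPrime G → IsPrime H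
isPrime-resp {G = G} {H} G≗H (4≤n , trivial) =
  4≤n , λ M module-M → trivial M (isModule-resp {G = H} {G} (λ x y → sym (G≗H x y)) module-M)

isModule-complement : ∀ (G : Graph n) {M} → IsModule G M → IsModule (complement G) M
isModule-complement G {M} module-M v v∉ x y x∈ y∈ = begin
  adj (complement G) v x ≡⟨ adj-complement G (v≢ x∈) ⟩
  not (adj G v x)        ≡⟨ cong not (module-M v v∉ x y x∈ y∈) ⟩
  not (adj G v y)        ≡⟨ adj-complement G (v≢ y∈) ⟨
  adj (complement G) v y ∎
  where
  open ≡-Reasoning
  v≢ : ∀ {x} → x ∈ M → v ≢ x
  v≢ x∈ refl = v∉ x∈

isModule-complement⁻ : ∀ (G : Graph n) {M} → IsModule (complement G) M → IsModule G M
isModule-complement⁻ G module-M = isModule-resp {G = complement (complement G)} {G}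
  (complement-involutive G) (isModule-complement (complement G) module-M)

isPrime-complement : ∀ (G : Graph n) → IsPrime G → IsPrime (complement G)
isPrime-complement G (4≤n , trivial) = 4≤n , λ M module-M → trivial M (isModule-complement⁻ G module-M)

isStable⇒isClique-complement : ∀ (G : Graph n) {M} → IsStable G M → IsClique (complement G) M
isStable⇒isClique-complement G stable x y x∈ y∈ x≢y =
  trans (adj-complement G x≢y) (cong not (stable x y x∈ y∈))

isClique⇒isStable-complement : ∀ (G : Graph n) {M} → IsClique G M → IsStable (complement G) M
isClique⇒isStable-complement G clique x y x∈ y∈ with x Fin.≟ y
... | yes _   = refl
... | no  x≢y = cong not (clique x y x∈ y∈ x≢y)

isClique-complement⁻ : ∀ (G : Graph n) {M} → IsClique (complement G) M → IsStable G M
isClique-complement⁻ G clique x y x∈ y∈ = trans (sym (complement-involutive G x y))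
  (isClique⇒isStable-complement (complement G) clique x y x∈ y∈)

isStable-complement⁻ : ∀ (G : Graph n) {M} → IsStable (complement G) M → IsClique G M
isStable-complement⁻ G stable x y x∈ y∈ x≢y = trans (sym (complement-involutive G x y))
  (isStable⇒isClique-complement (complement G) stable x y x∈ y∈ x≢y)

isOmegaM⇒isAlphaM-complement : ∀ (G : Graph n) → IsOmegaM G k → IsAlphaM (complement G) k
isOmegaM⇒isAlphaM-complement G ((M , module-M , clique , size) , maximal) =
  (M , isModule-complement G module-M , isClique⇒isStable-complement G clique , size) ,
  λ N module-N stable → maximal N (isModule-complement⁻ G module-N) (isStable-complement⁻ G stable)

isAlphaM⇒isOmegaM-complement : ∀ (G : Graph n) → IsAlphaM G k → IsOmegaM (complement G) k
isAlphaM⇒isOmegaM-complement G ((M , module-M , stable , size) , maximal) =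
  (M , isModule-complement G module-M , isStable⇒isClique-complement G stable , size) ,
  λ N module-N clique → maximal N (isModule-complement⁻ G module-N) (isClique-complement⁻ G clique)

hasPrimeExtension-complement⁻ : ∀ (G : Graph n) → HasPrimeExtension (complement G) p → HasPrimeExtension G p
hasPrimeExtension-complement⁻ {p = p} G (H , ext , prime) = complement H , ext′ , isPrime-complement H prime
  where
  ext′ : IsExtension p G (complement H)
  ext′ x y with x Fin.≟ y
  ... | yes refl = trans (irrefl (complement H) (x ↑ˡ p)) (sym (irrefl G x))
  ... | no  x≢y  = begin
    adj (complement H) (x ↑ˡ p) (y ↑ˡ p) ≡⟨ adj-complement H (x≢y ∘ Fin.↑ˡ-injective p x y) ⟩
    not (adj H (x ↑ˡ p) (y ↑ˡ p))        ≡⟨ cong not (ext x y) ⟩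
    not (adj (complement G) x y)         ≡⟨ cong not (adj-complement G x≢y) ⟩
    not (not (adj G x y))                ≡⟨ Bool.not-involutive _ ⟩
    adj G x y                            ∎
    where open ≡-Reasoning

-- The upper bound.

n≤2*⌈n/2⌉ : ∀ n → n ≤ 2 * ⌈ n /2⌉
n≤2*⌈n/2⌉ zero = z≤n
n≤2*⌈n/2⌉ (suc zero) = s≤s z≤n
n≤2*⌈n/2⌉ (suc (suc n)) rewrite ℕ.*-suc 2 ⌈ n /2⌉ = s≤s (s≤s (n≤2*⌈n/2⌉ n))

n≤2^⌈log₂n⌉ : ∀ n → n ≤ 2 ^ ⌈log₂ n ⌉
n≤2^⌈log₂n⌉ n = go n (<-wellFounded n)
  where
  open ℕ.≤-Reasoning
  go : ∀ n → Acc _<_ n → n ≤ 2 ^ ⌈log₂ n ⌉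
  go zero          _ = z≤n
  go (suc zero)    _ = ℕ.m^n>0 2 ⌈log₂ 1 ⌉
  go n@(suc (suc m)) (acc rec) = begin
    n                          ≤⟨ n≤2*⌈n/2⌉ n ⟩
    2 * ⌈ n /2⌉                ≤⟨ ℕ.*-monoʳ-≤ 2 (go ⌈ n /2⌉ (rec (ℕ.⌈n/2⌉<n m))) ⟩
    2 ^ suc ⌈log₂ ⌈ n /2⌉ ⌉    ≡⟨ cong (2 ^_) (trans (cong suc (Log.⌈log₂⌈n/2⌉⌉≡⌈log₂n⌉∸1 n))
                                    (ℕ.m+[n∸m]≡n (Log.⌈log₂⌉-mono-≤ {2} {n} (s≤s (s≤s z≤n))))) ⟩
    2 ^ ⌈log₂ n ⌉              ∎

k<⌈log₂n⌉⇒2^k<n : ∀ {n k} → k < ⌈log₂ n ⌉ → 2 ^ k < n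
k<⌈log₂n⌉⇒2^k<n {n} {k} k< = ℕ.≰⇒> λ n≤ → ℕ.<⇒≱ k<
  (ℕ.≤-trans (Log.⌈log₂⌉-mono-≤ n≤) (ℕ.≤-reflexive (Log.⌈log₂2^n⌉≡n k)))

primeExtension-stable : ∀ (G : Graph n) {a w} → IsAlphaM G a → IsOmegaM G w → 2 ≤ a → w ≤ a →
  HasPrimeExtension G ⌈log₂ (suc a) ⌉
primeExtension-stable {n} G {a} {w} ((M , module-M , stable-M , refl) , max-stable) (_ , max-clique) 2≤a w≤a
  with v₀ , v , v₀∈M , v∈M , v₀≢v ← 2≤∣S∣⇒hasPair M 2≤a
  -- From `3 ≤ suc a` the logarithm is at least 2, which gives it the form `2 + q`.
  with ⌈log₂ (suc a) ⌉ in p≡ | Log.⌈log₂⌉-mono-≤ {3} (s≤s 2≤a)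
... | suc zero    | s≤s ()
... | suc (suc q) | _ = Construction.hasPrimeExtension G q v₀ stable small large
  where
  ∈C : ∀ {x} → x ∈ M → x ∈ twinClass G v₀
  ∈C x∈ = ∈-twinClass⁺ G (stableModule⇒twins G module-M stable-M x∈ v₀∈M)

  stable : IsStable G (twinClass G v₀)
  stable with isStable⊎isClique-twinClass G v₀
  ... | inj₁ stable = stable
  ... | inj₂ clique = contradiction
    (trans (sym (clique v₀ v (∈C v₀∈M) (∈C v∈M) v₀≢v)) (stable-M v₀ v v₀∈M v∈M)) λ ()

  size : ∀ u → ∣ twinClass G u ∣ ≤ a
  size u with isStable⊎isClique-twinClass G u
  ... | inj₁ s = max-stable _ (isModule-twinClass G u) s
  ... | inj₂ c = ℕ.≤-trans (max-clique _ (isModule-twinClass G u) c) w≤a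

  small : ∀ u → ∣ twinClass G u ∣ < 2 ^ (2 + q)
  small u = ℕ.≤-trans (s≤s (size u)) (subst (λ p → suc a ≤ 2 ^ p) p≡ (n≤2^⌈log₂n⌉ (suc a)))

  -- Below the ceiling of the logarithm, `2 ^ toℕ t < suc a`; the class contains a stable module of
  -- size `a`.
  large : ∀ (t : Fin (2 + q)) → 2 ^ toℕ t ≤ ∣ twinClass G v₀ ∣
  large t = ℕ.≤-trans
    (ℕ.≤-pred (k<⌈log₂n⌉⇒2^k<n (subst (toℕ t <_) (sym p≡) (Fin.toℕ<n t))))
    (p⊆q⇒∣p∣≤∣q∣ ∈C)

primeExtension : ∀ (G : Graph n) {a w} → IsAlphaM G a → IsOmegaM G w → 2 ≤ a ⊔ w →
  HasPrimeExtension G ⌈log₂ (suc (a ⊔ w)) ⌉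
primeExtension G {a} {w} isα isω 2≤ with ℕ.≤-total w a
... | inj₁ w≤a rewrite ℕ.m≥n⇒m⊔n≡m w≤a = primeExtension-stable G isα isω 2≤ w≤a
... | inj₂ a≤w rewrite ℕ.m≤n⇒m⊔n≡n a≤w = hasPrimeExtension-complement⁻ G
  (primeExtension-stable (complement G)
    (isOmegaM⇒isAlphaM-complement G isω) (isAlphaM⇒isOmegaM-complement G isα) 2≤ a≤w)

-- The lower bound.

cliqueModule⇒twins : ∀ (G : Graph n) {M} → IsModule G M → IsClique G M → ∀ {x y} → x ∈ M → y ∈ M → Twin G x y
cliqueModule⇒twins G {M} module-M clique {x} {y} x∈ y∈ w w≢x w≢y with w ∈? M
... | yes w∈ = trans (clique w x w∈ x∈ w≢x) (sym (clique w y w∈ y∈ w≢y))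
... | no  w∉ = module-M w w∉ x y x∈ y∈

∃∉-pair : 4 ≤ n → ∀ (x y : Fin n) → ∃ λ z → z ∉ pair x y
∃∉-pair {n} 4≤n x y = ¬∀⟶∃¬ n (_∈ pair x y) (_∈? pair x y) λ full →
  let i , j , i<j , eq = Fin.pigeonhole (ℕ.≤-trans (ℕ.n≤1+n 3) 4≤n) side
  in Fin.<⇒≢ i<j (side-injective (full i) (full j) eq)
  where
  side : Fin n → Fin 2
  side z = if does (z Fin.≟ x) then zero else suc zero

  side-injective : ∀ {i j} → i ∈ pair x y → j ∈ pair x y → side i ≡ side j → i ≡ j
  side-injective {i} {j} i∈ j∈ eq with i Fin.≟ x | j Fin.≟ x | ∈-pair⁻ i∈ | ∈-pair⁻ j∈
  ... | yes i≡x | yes j≡x | _ | _ = trans i≡x (sym j≡x)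
  ... | no i≢x | _ | inj₁ i≡x | _ = contradiction i≡x i≢x
  ... | no _ | no j≢x | _ | inj₁ j≡x = contradiction j≡x j≢x
  ... | no _ | no _ | inj₂ i≡y | inj₂ j≡y = trans i≡y (sym j≡y)

isPrime⇒¬twins : ∀ {G : Graph n} → IsPrime G → ∀ {x y} → x ≢ y → ¬ Twin G x y
isPrime⇒¬twins {G = G} (4≤n , trivial) {x} {y} x≢y t with trivial (pair x y) (twin⇒isModule-pair G t)
... | inj₁ ≡⊥ = ∉⊥ (subst (x ∈_) ≡⊥ (∈-pairˡ x y))
... | inj₂ (inj₁ ≡⊤) with z , z∉ ← ∃∉-pair 4≤n x y = z∉ (subst (z ∈_) (sym ≡⊤) ∈⊤)
... | inj₂ (inj₂ (v , ≡v)) = x≢y (trans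
  (x∈⁅y⁆⇒x≡y v (subst (x ∈_) ≡v (∈-pairˡ x y))) (sym (x∈⁅y⁆⇒x≡y v (subst (y ∈_) ≡v (∈-pairʳ x y)))))

fromBool : Bool → Fin 2
fromBool b = if b then zero else suc zero

fromBool-injective : ∀ {a b} → fromBool a ≡ fromBool b → a ≡ b
fromBool-injective {true}  {true}  _ = refl
fromBool-injective {false} {false} _ = refl

-- Twins of `G` with the same trace on the new vertices remain twins in `H`, which is impossible in
-- a prime graph; there are only `2 ^ q` traces.
twins-≤-2^ : ∀ (G : Graph n) M → (∀ {x y} → x ∈ M → y ∈ M → Twin G x y) →
  HasPrimeExtension G q → ∣ M ∣ ≤ 2 ^ q
twins-≤-2^ {n} {q} G M twins (H , ext , prime) = ℕ.≮⇒≥ λ 2^q<∣M∣ →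
  let i , j , i<j , eq = Fin.pigeonhole 2^q<∣M∣ code
  in isPrime⇒¬twins {G = H} prime
       (Fin.<⇒≢ i<j ∘ element-injective ∘ Fin.↑ˡ-injective q _ _) (same-code⇒twin i j eq)
  where
  element : Fin ∣ M ∣ → Fin n
  element i = proj₁ (position-surjective M (Fin.toℕ<n i))

  element∈ : ∀ i → element i ∈ M
  element∈ i = proj₁ (proj₂ (position-surjective M (Fin.toℕ<n i)))

  element-injective : ∀ {i j} → element i ≡ element j → i ≡ j
  element-injective {i} {j} eq = Fin.toℕ-injective (begin
    toℕ i                  ≡⟨ proj₂ (proj₂ (position-surjective M (Fin.toℕ<n i))) ⟨
    position M (element i) ≡⟨ cong (position M) eq ⟩
    position M (element j) ≡⟨ proj₂ (proj₂ (position-surjective M (Fin.toℕ<n j))) ⟩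
    toℕ j                  ∎)
    where open ≡-Reasoning

  trace : Fin ∣ M ∣ → Fin q → Fin 2
  trace i t = fromBool (adj H (n ↑ʳ t) (element i ↑ˡ q))

  code : Fin ∣ M ∣ → Fin (2 ^ q)
  code i = funToFin (trace i)

  same-code⇒twin : ∀ i j → code i ≡ code j → Twin H (element i ↑ˡ q) (element j ↑ˡ q)
  same-code⇒twin i j eq w w≢x w≢y with splitAt n w in split-w
  ... | inj₁ v with refl ← Fin.splitAt⁻¹-↑ˡ split-w = begin
    adj H (v ↑ˡ q) (element i ↑ˡ q) ≡⟨ ext v (element i) ⟩
    adj G v (element i)             ≡⟨ twins (element∈ i) (element∈ j) v (w≢x ∘ cong (_↑ˡ q)) (w≢y ∘ cong (_↑ˡ q)) ⟩
    adj G v (element j)             ≡⟨ ext v (element j) ⟨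
    adj H (v ↑ˡ q) (element j ↑ˡ q) ∎
    where open ≡-Reasoning
  ... | inj₂ t with refl ← Fin.splitAt⁻¹-↑ʳ {n} split-w = fromBool-injective (begin
    trace i t              ≡⟨ Fin.finToFun-funToFin (trace i) t ⟨
    finToFun (code i) t    ≡⟨ cong (λ c → finToFun c t) eq ⟩
    finToFun (code j) t    ≡⟨ Fin.finToFun-funToFin (trace j) t ⟩
    trace j t              ∎)
    where open ≡-Reasoning

-- Decidability of prime extensions and the least number of new vertices.

decode : Subset (n * n) → Graph n
decode {n} S = record
  -- Requiring both orders and excluding loops makes every subset decode to a graph.
  { adj    = λ x y → edge x y ∧ edge y x
  ; sym    = λ x y → Bool.∧-comm (edge x y) (edge y x)
  ; irrefl = λ x → trans (Bool.∧-idem (edge x x)) (loopless x)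
  }
  where
  edge : Fin n → Fin n → Bool
  edge x y = not (does (x Fin.≟ y)) ∧ lookup S (combine x y)

  loopless : ∀ x → edge x x ≡ false
  loopless x rewrite dec-true (x Fin.≟ x) refl = refl

encode : Graph n → Subset (n * n)
encode {n} G = tabulate λ i → adj G (proj₁ (remQuot {n} n i)) (proj₂ (remQuot {n} n i))

decode-encode : ∀ (G : Graph n) x y → adj (decode (encode G)) x y ≡ adj G x y
decode-encode {n} G x y = begin
  edge x y ∧ edge y x  ≡⟨ cong₂ _∧_ (edge-encode x y) (edge-encode y x) ⟩
  adj G x y ∧ adj G y x ≡⟨ cong (adj G x y ∧_) (Graph.sym G y x) ⟩
  adj G x y ∧ adj G x y ≡⟨ Bool.∧-idem (adj G x y) ⟩
  adj G x y            ∎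
  where
  open ≡-Reasoning
  edge : Fin n → Fin n → Bool
  edge x y = not (does (x Fin.≟ y)) ∧ lookup (encode G) (combine x y)

  edge-encode : ∀ x y → edge x y ≡ adj G x y
  edge-encode x y with x Fin.≟ y
  ... | yes refl = sym (irrefl G x)
  ... | no  _    = trans (Vec.lookup∘tabulate _ (combine x y))
    (cong (λ xy → adj G (proj₁ xy) (proj₂ xy)) (Fin.remQuot-combine x y))

isTrivial? : Decidable (IsTrivial {n})
isTrivial? M = (M ≟ ⊥) ⊎-dec (M ≟ ⊤) ⊎-dec any? λ v → M ≟ ⁅ v ⁆
  where _≟_ = Vec.≡-dec Bool._≟_

isPrime? : Decidable (IsPrime {n})
isPrime? {n} G = (4 ℕ.≤? n) ×-dec allSubset? λ M → isModule? G M →-dec isTrivial? M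

isExtension? : ∀ (G : Graph n) → Decidable (IsExtension p G)
isExtension? {p = p} G H = all? λ x → all? λ y → adj H (x ↑ˡ p) (y ↑ˡ p) Bool.≟ adj G x y

-- Graphs are coded by subsets of a finite set, so the search is finite; this makes the least `p`
-- available constructively.
hasPrimeExtension? : ∀ (G : Graph n) → Decidable (HasPrimeExtension G)
hasPrimeExtension? G p = map′
  (λ (S , ext , prime) → decode S , ext , prime)
  (λ (H , ext , prime) → encode H ,
    (λ x y → trans (decode-encode H (x ↑ˡ p) (y ↑ˡ p)) (ext x y)) ,
    isPrime-resp {G = H} {decode (encode H)} (λ x y → sym (decode-encode H x y)) prime)
  (anySubset? λ S → isExtension? {p = p} G (decode S) ×-dec isPrime? (decode S))

least : ∀ {P : ℕ → Set} → Decidable P → ∀ k → P k → ∃ λ m → P m × m ≤ k × (∀ j → P j → m ≤ j)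
least P? k Pk with P? zero
... | yes P0 = zero , P0 , z≤n , λ _ _ → z≤n
least P? zero    Pk | no ¬P0 = contradiction Pk ¬P0
least P? (suc k) Pk | no ¬P0 with m , Pm , m≤k , lower ← least (P? ∘ suc) k Pk =
  suc m , Pm , s≤s m≤k , λ { zero P0 → contradiction P0 ¬P0 ; (suc j) Pj → s≤s (lower j Pj) }

theorem3 : ∀ {n} (G : Graph n) (a w : ℕ) → IsAlphaM G a → IsOmegaM G w →
    2 ≤ a ⊔ w →
    Σ ℕ λ p → IsPrimeBound G p × ⌈log₂ (a ⊔ w) ⌉ ≤ p × p ≤ ⌈log₂ (a ⊔ w + 1) ⌉
theorem3 G a w isα@((A , module-A , stable-A , ∣A∣) , _) isω@((W , module-W , clique-W , ∣W∣) , _) 2≤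
  -- The extension from the upper bound starts the search for the least `p` and bounds it.
  with p , ext , p≤ , minimal ← least (hasPrimeExtension? G) _ (primeExtension G isα isω 2≤)
  = p , (ext , minimal)
  -- Both `a` and `w` are at most `2 ^ p`, whose logarithm is `p`.
  , ℕ.≤-trans (Log.⌈log₂⌉-mono-≤ (ℕ.⊔-lub
      (subst (_≤ 2 ^ p) ∣A∣ (twins-≤-2^ G A (stableModule⇒twins G module-A stable-A) ext))
      (subst (_≤ 2 ^ p) ∣W∣ (twins-≤-2^ G W (cliqueModule⇒twins G module-W clique-W) ext))))
      (ℕ.≤-reflexive (Log.⌈log₂2^n⌉≡n p))
  , subst (λ m → p ≤ ⌈log₂ m ⌉) (ℕ.+-comm 1 (a ⊔ w)) p≤
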